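{- For any positive integers $k,n$, one has $D^{\mathrm{mon}}_k(n)\le k\cdot D^{\mathrm{perm}}_k(n)$.
   Context: Monotone matrices: a matrix $A$ with $m$ rows and $n$ columns is $k$-monotone if $A\in\{0,1,\dots,k\}^{m\times n}$ and $A_{1j}\le\dots\le A_{mj}$ for every column $j$. The linear discrepancy of $A\in\mathbb R^{m\times n}$ is $\mathrm{lindisc}(A)=\max_{y\in[0,1]^n}\min_{x\in\{0,1\}^n}\|Ax-Ay\|_\infty$. $D^{\mathrm{mon}}_k(n)$ is the maximum of $\mathrm{lindisc}(A)$ over all $k$-monotone matrices $A\in\mathbb Z^{m\times n}$ with $n$ columns and any number $m$ of rows. Discrepancy of permutations: write $[n]=\{1,\dots,n\}$. For a set system $\mathcal S\subseteq2^{[n]}$, $\mathrm{disc}(\mathcal S)=\min_{\chi:[n]\to\{\pm1\}}\max_{S\in\mathcal S}|\chi(S)|$ with $\chi(S)=\sum_{i\in S}\chi(i)$. Permutations $\pi_1,\dots,\pi_k$ of $[n]$ induce the set system $\{\{\pi_i(1),\dots,\pi_i(j)\} : j=1,\dots,n;\ i=1,\dots,k\}$. $D^{\mathrm{perm}}_k(n)$ is the maximum discrepancy of such a set system over all choices of $k$ permutations of $[n]$. -}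

module Defs where

open import Data.Bool.Base using (if_then_else_)
open import Data.Fin.Base as Fin using (Fin; zero; suc)
import Data.Fin.Properties as Fin
open import Data.Fin.Permutation as Perm
  using (Permutation′; _⟨$⟩ʳ_; insert; remove; insert-remove; insert-punchIn)
open import Data.Fin.Subset using (Subset; ⁅_⁆; ⋃)
open import Data.Integer.Base as ℤ using (ℤ; +_; 0ℤ; _◃_)
open import Data.List.Base as List using (List; []; _∷_; [_]; allFin; filter; cartesianProductWith)
open import Data.List.Extrema.Nat using (max)
open import Data.List.Membership.Propositional using (_∈_)
open import Data.List.Membership.Propositional.Properties
  using (∈-cartesianProductWith⁺; ∈-allFin)
open import Data.List.Relation.Unary.Any using (here)
open import Data.Nat.Base as ℕ using (ℕ; zero; suc)
import Data.Nat.Properties as ℕ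
open import Data.Product.Base using (Σ; ∃; _×_; _,_)
open import Data.Rational.Base as ℚ using (ℚ; 0ℚ; 1ℚ; ½)
import Data.Rational.Properties as ℚ
open import Data.Rational.Solver using (module +-*-Solver)
open import Data.Sign.Base as Sign using (Sign)
open import Data.Sum.Base using (inj₁; inj₂)
open import Data.Vec.Base as Vec using (Vec; []; _∷_; lookup)
open import Data.Vec.Functional as Vector using (Vector)
open import Function.Base using (_∘_)
open import Relation.Binary.PropositionalEquality
  using (_≡_; refl; sym; trans; cong; cong₂; subst; subst₂)

------------------------------------------------------------------------
-- Rational estimates

private
  open +-*-Solver using (solve; _:+_; _:*_; _:-_; :-_; _:=_; con)

  p≤∣p∣ : ∀ p → p ℚ.≤ ℚ.∣ p ∣
  p≤∣p∣ p with ℚ.∣p∣≡p∨∣p∣≡-p p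
  ... | inj₁ eq = ℚ.≤-reflexive (sym eq)
  ... | inj₂ eq = ℚ.≤-trans p≤0 (ℚ.0≤∣p∣ p)
    where
    p≤0 : p ℚ.≤ 0ℚ
    p≤0 = subst (ℚ._≤ 0ℚ) (solve 1 (λ a → :- (:- a) := a) refl p)
            (ℚ.neg-antimono-≤ (subst (0ℚ ℚ.≤_) eq (ℚ.0≤∣p∣ p)))

  a-b≤c⇒a≤b+c : ∀ a b c → a ℚ.- b ℚ.≤ c → a ℚ.≤ b ℚ.+ c
  a-b≤c⇒a≤b+c a b c h =
    subst (ℚ._≤ b ℚ.+ c) (solve 2 (λ a b → b :+ (a :- b) := a) refl a b) (ℚ.+-monoʳ-≤ b h)

  a≤b+c⇒a-b≤c : ∀ a b c → a ℚ.≤ b ℚ.+ c → a ℚ.- b ℚ.≤ c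
  a≤b+c⇒a-b≤c a b c h =
    subst (a ℚ.- b ℚ.≤_) (solve 2 (λ b c → (b :+ c) :- b := c) refl b c) (ℚ.+-monoˡ-≤ (ℚ.- b) h)

  ∣a-b∣≡∣b-a∣ : ∀ a b → ℚ.∣ a ℚ.- b ∣ ≡ ℚ.∣ b ℚ.- a ∣
  ∣a-b∣≡∣b-a∣ a b = trans (cong ℚ.∣_∣ (solve 2 (λ a b → a :- b := :- (b :- a)) refl a b))
                          (ℚ.∣-p∣≡∣p∣ (b ℚ.- a))

  ∣a-b∣≤c⇒a≤b+c : ∀ a b {c} → ℚ.∣ a ℚ.- b ∣ ℚ.≤ c → a ℚ.≤ b ℚ.+ c
  ∣a-b∣≤c⇒a≤b+c a b h = a-b≤c⇒a≤b+c a b _ (ℚ.≤-trans (p≤∣p∣ (a ℚ.- b)) h)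

  ∣a-b∣≤c⇒b≤a+c : ∀ a b {c} → ℚ.∣ a ℚ.- b ∣ ℚ.≤ c → b ℚ.≤ a ℚ.+ c
  ∣a-b∣≤c⇒b≤a+c a b h = ∣a-b∣≤c⇒a≤b+c b a (subst (ℚ._≤ _) (∣a-b∣≡∣b-a∣ a b) h)

  a≤b+c∧b≤a+c⇒∣a-b∣≤c : ∀ a b {c} → a ℚ.≤ b ℚ.+ c → b ℚ.≤ a ℚ.+ c → ℚ.∣ a ℚ.- b ∣ ℚ.≤ c
  a≤b+c∧b≤a+c⇒∣a-b∣≤c a b h h′ with ℚ.∣p∣≡p∨∣p∣≡-p (a ℚ.- b)
  ... | inj₁ eq = subst (ℚ._≤ _) (sym eq) (a≤b+c⇒a-b≤c a b _ h)
  ... | inj₂ eq = subst (ℚ._≤ _)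
                    (sym (trans eq (solve 2 (λ a b → :- (a :- b) := b :- a) refl a b)))
                    (a≤b+c⇒a-b≤c b a _ h′)

  ∣-∣-lipschitz : ∀ a b → ℚ.∣ ℚ.∣ a ∣ ℚ.- ℚ.∣ b ∣ ∣ ℚ.≤ ℚ.∣ a ℚ.- b ∣
  ∣-∣-lipschitz a b = a≤b+c∧b≤a+c⇒∣a-b∣≤c ℚ.∣ a ∣ ℚ.∣ b ∣
    (bound a b)
    (subst (λ t → ℚ.∣ b ∣ ℚ.≤ ℚ.∣ a ∣ ℚ.+ t) (∣a-b∣≡∣b-a∣ b a) (bound b a))
    where
    bound : ∀ a b → ℚ.∣ a ∣ ℚ.≤ ℚ.∣ b ∣ ℚ.+ ℚ.∣ a ℚ.- b ∣
    bound a b = subst (λ t → ℚ.∣ t ∣ ℚ.≤ ℚ.∣ b ∣ ℚ.+ ℚ.∣ a ℚ.- b ∣)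
      (solve 2 (λ a b → b :+ (a :- b) := a) refl a b)
      (ℚ.∣p+q∣≤∣p∣+∣q∣ b (a ℚ.- b))

  ⊔-close : ∀ a b c d {ε} → ℚ.∣ a ℚ.- c ∣ ℚ.≤ ε → ℚ.∣ b ℚ.- d ∣ ℚ.≤ ε →
            ℚ.∣ (a ℚ.⊔ b) ℚ.- (c ℚ.⊔ d) ∣ ℚ.≤ ε
  ⊔-close a b c d {ε} h h′ = a≤b+c∧b≤a+c⇒∣a-b∣≤c (a ℚ.⊔ b) (c ℚ.⊔ d)
    (half a b c d (∣a-b∣≤c⇒a≤b+c a c h) (∣a-b∣≤c⇒a≤b+c b d h′))
    (half c d a b (∣a-b∣≤c⇒b≤a+c a c h) (∣a-b∣≤c⇒b≤a+c b d h′))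
    where
    half : ∀ a b c d → a ℚ.≤ c ℚ.+ ε → b ℚ.≤ d ℚ.+ ε → a ℚ.⊔ b ℚ.≤ (c ℚ.⊔ d) ℚ.+ ε
    half a b c d p q = ℚ.⊔-lub
      (ℚ.≤-trans p (ℚ.+-monoˡ-≤ ε (ℚ.p≤p⊔q c d)))
      (ℚ.≤-trans q (ℚ.+-monoˡ-≤ ε (ℚ.p≤q⊔p c d)))

  ⊓-close : ∀ a b c d {ε} → ℚ.∣ a ℚ.- c ∣ ℚ.≤ ε → ℚ.∣ b ℚ.- d ∣ ℚ.≤ ε →
            ℚ.∣ (a ℚ.⊓ b) ℚ.- (c ℚ.⊓ d) ∣ ℚ.≤ ε
  ⊓-close a b c d {ε} h h′ = a≤b+c∧b≤a+c⇒∣a-b∣≤c (a ℚ.⊓ b) (c ℚ.⊓ d)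
    (half a b c d (∣a-b∣≤c⇒a≤b+c a c h) (∣a-b∣≤c⇒a≤b+c b d h′))
    (half c d a b (∣a-b∣≤c⇒b≤a+c a c h) (∣a-b∣≤c⇒b≤a+c b d h′))
    where
    half : ∀ a b c d → a ℚ.≤ c ℚ.+ ε → b ℚ.≤ d ℚ.+ ε → a ℚ.⊓ b ℚ.≤ (c ℚ.⊓ d) ℚ.+ ε
    half a b c d p q = subst (a ℚ.⊓ b ℚ.≤_)
      (sym (ℚ.mono-≤-distrib-⊓ (ℚ.+-monoˡ-≤ ε) c d))
      (ℚ.⊓-glb (ℚ.≤-trans (ℚ.p⊓q≤p a b) p) (ℚ.≤-trans (ℚ.p⊓q≤q a b) q))

  0<½*_ : ∀ {ε} → 0ℚ ℚ.< ε → 0ℚ ℚ.< ½ ℚ.* ε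
  0<½*_ {ε} h = subst (ℚ._< ½ ℚ.* ε) (ℚ.*-zeroʳ ½) (ℚ.*-monoʳ-<-pos ½ h)

  ½+½ : ∀ ε → ½ ℚ.* ε ℚ.+ ½ ℚ.* ε ≡ ε
  ½+½ ε = trans (sym (ℚ.*-distribʳ-+ ε ½ ½)) (ℚ.*-identityˡ ε)

  p<p+ε : ∀ p {ε} → 0ℚ ℚ.< ε → p ℚ.< p ℚ.+ ε
  p<p+ε p {ε} h = subst (ℚ._< p ℚ.+ ε) (ℚ.+-identityʳ p) (ℚ.+-monoʳ-< p h)

  0<p*q : ∀ p q → 0ℚ ℚ.< p → 0ℚ ℚ.< q → 0ℚ ℚ.< p ℚ.* q
  0<p*q p q hp hq = subst (ℚ._< p ℚ.* q) (ℚ.*-zeroʳ p)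
    (ℚ.*-monoʳ-<-pos p {{ℚ.positive hp}} hq)

  *-mono-≤ : ∀ {a b c d} → 0ℚ ℚ.≤ b → 0ℚ ℚ.≤ c → a ℚ.≤ b → c ℚ.≤ d → a ℚ.* c ℚ.≤ b ℚ.* d
  *-mono-≤ {a} {b} {c} {d} 0≤b 0≤c a≤b c≤d = ℚ.≤-trans
    (ℚ.*-monoʳ-≤-nonNeg c {{ℚ.nonNegative 0≤c}} a≤b)
    (ℚ.*-monoˡ-≤-nonNeg b {{ℚ.nonNegative 0≤b}} c≤d)

  share : ∀ B {ε} → 0ℚ ℚ.< B → 0ℚ ℚ.< ε → ∃ λ δ → 0ℚ ℚ.< δ × B ℚ.* δ ≡ ½ ℚ.* ε
  share B {ε} 0<B 0<ε = B⁻¹ ℚ.* (½ ℚ.* ε)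
    , 0<p*q B⁻¹ (½ ℚ.* ε) (ℚ.positive⁻¹ B⁻¹ {{ℚ.1/pos⇒pos B}}) (0<½* 0<ε)
    , trans (sym (ℚ.*-assoc B B⁻¹ (½ ℚ.* ε)))
        (trans (cong (ℚ._* (½ ℚ.* ε)) (ℚ.*-inverseʳ B)) (ℚ.*-identityˡ (½ ℚ.* ε)))
    where
    instance
      _ = ℚ.positive 0<B
      _ = ℚ.pos⇒nonZero B
    B⁻¹ = ℚ.1/ B

------------------------------------------------------------------------
-- Real numbers, as Cauchy sequences of rationals

IsCauchy : (ℕ → ℚ) → Set
IsCauchy x = ∀ ε → 0ℚ ℚ.< ε → ∃ λ N → ∀ m n → N ℕ.≤ m → N ℕ.≤ n → ℚ.∣ x m ℚ.- x n ∣ ℚ.≤ ε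

record ℝ : Set where
  constructor mkℝ
  field
    seq    : ℕ → ℚ
    cauchy : IsCauchy seq

open ℝ public

infix  4 _≤ᴿ_ _<ᴿ_
infixl 6 _+ᴿ_ _-ᴿ_ _⊔ᴿ_
infixl 7 _*ᴿ_ _⊓ᴿ_

_≤ᴿ_ : ℝ → ℝ → Set
x ≤ᴿ y = ∀ ε → 0ℚ ℚ.< ε → ∃ λ N → ∀ n → N ℕ.≤ n → seq x n ℚ.≤ seq y n ℚ.+ ε

_<ᴿ_ : ℝ → ℝ → Set
x <ᴿ y = ∃ λ ε → 0ℚ ℚ.< ε × ∃ λ N → ∀ n → N ℕ.≤ n → seq x n ℚ.+ ε ℚ.≤ seq y n

fromℚ : ℚ → ℝ
fromℚ q = mkℝ (λ _ → q) λ ε 0<ε → 0 , λ _ _ _ _ →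
  subst (ℚ._≤ ε) (cong ℚ.∣_∣ (sym (ℚ.+-inverseʳ q))) (ℚ.<⇒≤ 0<ε)

fromℕ : ℕ → ℝ
fromℕ a = fromℚ (+ a ℚ./ 1)

0ᴿ 1ᴿ : ℝ
0ᴿ = fromℕ 0
1ᴿ = fromℕ 1

private
  both : ∀ x y {δ δ′} → 0ℚ ℚ.< δ → 0ℚ ℚ.< δ′ →
         ∃ λ N → ∀ m n → N ℕ.≤ m → N ℕ.≤ n →
           ℚ.∣ seq x m ℚ.- seq x n ∣ ℚ.≤ δ × ℚ.∣ seq y m ℚ.- seq y n ∣ ℚ.≤ δ′
  both x y {δ} {δ′} 0<δ 0<δ′ =
    let M , hx = cauchy x δ 0<δ
        N , hy = cauchy y δ′ 0<δ′
    in M ℕ.⊔ N , λ m n p q →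
         hx m n (ℕ.m⊔n≤o⇒m≤o M N p) (ℕ.m⊔n≤o⇒m≤o M N q) ,
         hy m n (ℕ.m⊔n≤o⇒n≤o M N p) (ℕ.m⊔n≤o⇒n≤o M N q)

  bounded : ∀ x → ∃ λ B → 0ℚ ℚ.< B × ∃ λ N → ∀ n → N ℕ.≤ n → ℚ.∣ seq x n ∣ ℚ.≤ B
  bounded x =
    let N , h = cauchy x 1ℚ (ℚ.positive⁻¹ 1ℚ)
    in ℚ.∣ seq x N ∣ ℚ.+ 1ℚ
     , ℚ.≤-<-trans (ℚ.0≤∣p∣ (seq x N)) (p<p+ε ℚ.∣ seq x N ∣ (ℚ.positive⁻¹ 1ℚ))
     , N
     , λ n p → ∣a-b∣≤c⇒a≤b+c ℚ.∣ seq x n ∣ ℚ.∣ seq x N ∣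
         (ℚ.≤-trans (∣-∣-lipschitz (seq x n) (seq x N)) (h n N p ℕ.≤-refl))

_+ᴿ_ : ℝ → ℝ → ℝ
x +ᴿ y = mkℝ (λ n → seq x n ℚ.+ seq y n) λ ε 0<ε →
  let N , h = both x y (0<½* 0<ε) (0<½* 0<ε)
  in N , λ m n p q →
    let a = seq x m ; b = seq y m ; c = seq x n ; d = seq y n
        hx , hy = h m n p q
    in subst₂ ℚ._≤_
         (cong ℚ.∣_∣ (solve 4 (λ a b c d → (a :- c) :+ (b :- d) := (a :+ b) :- (c :+ d)) refl a b c d))
         (½+½ ε)
         (ℚ.≤-trans (ℚ.∣p+q∣≤∣p∣+∣q∣ (a ℚ.- c) (b ℚ.- d)) (ℚ.+-mono-≤ hx hy))

-ᴿ_ : ℝ → ℝ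
-ᴿ x = mkℝ (λ n → ℚ.- seq x n) λ ε 0<ε →
  let N , h = cauchy x ε 0<ε
  in N , λ m n p q →
    let a = seq x m ; b = seq x n
    in subst (ℚ._≤ ε)
         (trans (∣a-b∣≡∣b-a∣ a b)
           (cong ℚ.∣_∣ (solve 2 (λ a b → b :- a := (:- a) :- (:- b)) refl a b)))
         (h m n p q)

_-ᴿ_ : ℝ → ℝ → ℝ
x -ᴿ y = x +ᴿ (-ᴿ y)

_*ᴿ_ : ℝ → ℝ → ℝ
x *ᴿ y = mkℝ (λ n → seq x n ℚ.* seq y n) λ ε 0<ε →
  let Bx , 0<Bx , Nx , hx = bounded x
      By , 0<By , Ny , hy = bounded y
      δx , 0<δx , By*δx = share By 0<By 0<ε
      δy , 0<δy , Bx*δy = share Bx 0<Bx 0<ε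
      N , h = both x y 0<δx 0<δy
  in (Nx ℕ.⊔ Ny) ℕ.⊔ N , λ m n p q →
    let a = seq x m ; b = seq y m ; c = seq x n ; d = seq y n
        p′ = ℕ.m⊔n≤o⇒m≤o (Nx ℕ.⊔ Ny) N p
        q′ = ℕ.m⊔n≤o⇒m≤o (Nx ℕ.⊔ Ny) N q
        cx , cy = h m n (ℕ.m⊔n≤o⇒n≤o (Nx ℕ.⊔ Ny) N p) (ℕ.m⊔n≤o⇒n≤o (Nx ℕ.⊔ Ny) N q)
        term₁ = subst₂ ℚ._≤_ (sym (ℚ.∣p*q∣≡∣p∣*∣q∣ a (b ℚ.- d))) Bx*δy
                  (*-mono-≤ (ℚ.<⇒≤ 0<Bx) (ℚ.0≤∣p∣ (b ℚ.- d))
                    (hx m (ℕ.m⊔n≤o⇒m≤o Nx Ny p′)) cy)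
        term₂ = subst₂ ℚ._≤_ (sym (ℚ.∣p*q∣≡∣p∣*∣q∣ d (a ℚ.- c))) By*δx
                  (*-mono-≤ (ℚ.<⇒≤ 0<By) (ℚ.0≤∣p∣ (a ℚ.- c))
                    (hy n (ℕ.m⊔n≤o⇒n≤o Nx Ny q′)) cx)
    in subst₂ ℚ._≤_
         (cong ℚ.∣_∣ (solve 4 (λ a b c d → a :* (b :- d) :+ d :* (a :- c) := a :* b :- c :* d)
                       refl a b c d))
         (½+½ ε)
         (ℚ.≤-trans (ℚ.∣p+q∣≤∣p∣+∣q∣ (a ℚ.* (b ℚ.- d)) (d ℚ.* (a ℚ.- c)))
                    (ℚ.+-mono-≤ term₁ term₂))

∣_∣ᴿ : ℝ → ℝ
∣ x ∣ᴿ = mkℝ (λ n → ℚ.∣ seq x n ∣) λ ε 0<ε →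
  let N , h = cauchy x ε 0<ε
  in N , λ m n p q → ℚ.≤-trans (∣-∣-lipschitz (seq x m) (seq x n)) (h m n p q)

_⊔ᴿ_ : ℝ → ℝ → ℝ
x ⊔ᴿ y = mkℝ (λ n → seq x n ℚ.⊔ seq y n) λ ε 0<ε →
  let N , h = both x y 0<ε 0<ε
  in N , λ m n p q → let hx , hy = h m n p q in
       ⊔-close (seq x m) (seq y m) (seq x n) (seq y n) hx hy

_⊓ᴿ_ : ℝ → ℝ → ℝ
x ⊓ᴿ y = mkℝ (λ n → seq x n ℚ.⊓ seq y n) λ ε 0<ε →
  let N , h = both x y 0<ε 0<ε
  in N , λ m n p q → let hx , hy = h m n p q in
       ⊓-close (seq x m) (seq y m) (seq x n) (seq y n) hx hy

------------------------------------------------------------------------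
-- Maxima over infinite families
--
-- Constructively, a maximum of infinitely many Cauchy reals cannot be
-- formed in general, so such maxima live in the one-sided Dedekind reals
-- (open lower cuts of ℚ, including the two improper cuts), ordered by
-- inclusion, where every family has a supremum. By sup-attained the
-- supremum is the maximum whenever it is attained, and by embed-mono and
-- embed-cancel the order extends that of ℝ.

record LowerReal : Set₁ where
  field
    Below   : ℚ → Set
    down    : ∀ {p q} → p ℚ.< q → Below q → Below p
    rounded : ∀ {p} → Below p → ∃ λ q → p ℚ.< q × Below q

open LowerReal public

infix 4 _≤ᴸ_

_≤ᴸ_ : LowerReal → LowerReal → Set
L ≤ᴸ M = ∀ q → Below L q → Below M q

sup : {I : Set} → (I → LowerReal) → LowerReal
sup f = record
  { Below   = λ q → ∃ λ i → Below (f i) q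
  ; down    = λ { p<q (i , b) → i , down (f i) p<q b }
  ; rounded = λ { (i , b) → let q , p<q , b′ = rounded (f i) b in q , p<q , i , b′ }
  }

embed : ℝ → LowerReal
embed x = record
  { Below   = λ q → fromℚ q <ᴿ x
  ; down    = λ { p<q (ε , 0<ε , N , h) → ε , 0<ε , N , λ n N≤n →
                  ℚ.≤-trans (ℚ.+-monoˡ-≤ ε (ℚ.<⇒≤ p<q)) (h n N≤n) }
  ; rounded = λ { {p} (ε , 0<ε , N , h) →
                  p ℚ.+ ½ ℚ.* ε , p<p+ε p (0<½* 0<ε) , ½ ℚ.* ε , 0<½* 0<ε , N , λ n N≤n →
                  subst (ℚ._≤ seq x n) (sym (halves p ε)) (h n N≤n) }
  }
  where
  halves : ∀ p ε → p ℚ.+ ½ ℚ.* ε ℚ.+ ½ ℚ.* ε ≡ p ℚ.+ ε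
  halves p ε = trans (ℚ.+-assoc p (½ ℚ.* ε) (½ ℚ.* ε)) (cong (p ℚ.+_) (½+½ ε))

sup-attained : {I : Set} (f : I → LowerReal) (i : I) → (∀ j → f j ≤ᴸ f i) →
               sup f ≤ᴸ f i × f i ≤ᴸ sup f
sup-attained f i greatest = (λ { q (j , b) → greatest j q b }) , λ q b → i , b

embed-mono : ∀ x y → x ≤ᴿ y → embed x ≤ᴸ embed y
embed-mono x y x≤y q (ε , 0<ε , M , h) =
  let N , h′ = x≤y (½ ℚ.* ε) (0<½* 0<ε)
  in ½ ℚ.* ε , 0<½* 0<ε , M ℕ.⊔ N , λ n p →
    subst₂ ℚ._≤_
      (trans (cong (ℚ._- ½ ℚ.* ε) (cong (q ℚ.+_) (sym (½+½ ε))))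
        (solve 2 (λ q e → (q :+ (e :+ e)) :- e := q :+ e) refl q (½ ℚ.* ε)))
      (solve 2 (λ y e → (y :+ e) :- e := y) refl (seq y n) (½ ℚ.* ε))
      (ℚ.+-monoˡ-≤ (ℚ.- (½ ℚ.* ε))
        (ℚ.≤-trans (h n (ℕ.m⊔n≤o⇒m≤o M N p)) (h′ n (ℕ.m⊔n≤o⇒n≤o M N p))))

embed-cancel : ∀ x y → embed x ≤ᴸ embed y → x ≤ᴿ y
embed-cancel x y x≤y ε 0<ε =
  let η = ½ ℚ.* (½ ℚ.* ε)
      0<η = 0<½* (0<½* 0<ε)
      N , h = cauchy x η 0<η
      q = seq x N ℚ.- (η ℚ.+ η)
      δ , 0<δ , M , h′ = x≤y q (η , 0<η , N , λ n p →
        subst₂ ℚ._≤_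
          (solve 2 (λ a e → a :- e := (a :- (e :+ e)) :+ e) refl (seq x N) η)
          (solve 2 (λ a e → (a :+ e) :- e := a) refl (seq x n) η)
          (ℚ.+-monoˡ-≤ (ℚ.- η) (∣a-b∣≤c⇒a≤b+c (seq x N) (seq x n) (h N n ℕ.≤-refl p))))
  in M ℕ.⊔ N , λ n p →
    let x≤ = ∣a-b∣≤c⇒a≤b+c (seq x n) (seq x N) (h n N (ℕ.m⊔n≤o⇒n≤o M N p) ℕ.≤-refl)
        q≤ = ℚ.≤-trans (ℚ.<⇒≤ (p<p+ε q 0<δ)) (h′ n (ℕ.m⊔n≤o⇒m≤o M N p))
    in ℚ.≤-trans x≤ (ℚ.≤-trans
         (subst (ℚ._≤ seq y n ℚ.+ (η ℚ.+ η ℚ.+ η))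
           (solve 2 (λ a e → (a :- (e :+ e)) :+ (e :+ e :+ e) := a :+ e) refl (seq x N) η)
           (ℚ.+-monoˡ-≤ (η ℚ.+ η ℚ.+ η) q≤))
         (ℚ.+-monoʳ-≤ (seq y n)
           (subst (η ℚ.+ η ℚ.+ η ℚ.≤_)
             (trans (cong₂ ℚ._+_ (½+½ (½ ℚ.* ε)) (½+½ (½ ℚ.* ε))) (½+½ ε))
             (subst (η ℚ.+ η ℚ.+ η ℚ.≤_) (ℚ.+-assoc (η ℚ.+ η) η η)
               (ℚ.<⇒≤ (p<p+ε (η ℚ.+ η ℚ.+ η) 0<η))))))

------------------------------------------------------------------------
-- Finite enumeration

-- Combines with _∙_ the values of f at all the vectors in {a , b}ⁿ.
overCube : {A B : Set} → (B → B → B) → A → A → ∀ n → (Vec A n → B) → B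
overCube _∙_ a b zero    f = f []
overCube _∙_ a b (suc n) f =
  overCube _∙_ a b n (f ∘ (a ∷_)) ∙ overCube _∙_ a b n (f ∘ (b ∷_))

tuples : {A : Set} → List A → ∀ k → List (Vec A k)
tuples xs zero    = [ [] ]
tuples xs (suc k) = cartesianProductWith _∷_ xs (tuples xs k)

allPermutations : ∀ n → List (Permutation′ n)
allPermutations zero    = [ Perm.id ]
allPermutations (suc n) = cartesianProductWith (insert zero) (allFin (suc n)) (allPermutations n)

tuples-complete : {A : Set} (xs : List A) {k : ℕ} (v : Vec A k) →
                  (∀ i → lookup v i ∈ xs) → v ∈ tuples xs k
tuples-complete xs []      h = here refl
tuples-complete xs (x ∷ v) h =
  ∈-cartesianProductWith⁺ _∷_ (h zero) (tuples-complete xs v (h ∘ suc))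

allPermutations-complete : ∀ n (π : Permutation′ n) →
                           ∃ λ ρ → ρ ∈ allPermutations n × π Perm.≈ ρ
allPermutations-complete zero    π = Perm.id , here refl , λ ()
allPermutations-complete (suc n) π =
  let ρ , ρ∈ , eq = allPermutations-complete n (remove zero π)
      j = π ⟨$⟩ʳ zero
  in insert zero j ρ
   , ∈-cartesianProductWith⁺ (insert zero) (∈-allFin j) ρ∈
   , λ i → trans (sym (insert-remove zero π i)) (insert-cong j (remove zero π) ρ eq i)
  where
  insert-cong : ∀ j (σ ρ : Permutation′ n) → σ Perm.≈ ρ → insert zero j σ Perm.≈ insert zero j ρ
  insert-cong j σ ρ eq zero    = refl
  insert-cong j σ ρ eq (suc i) =
    trans (insert-punchIn zero j σ i)
      (trans (cong (Fin.punchIn j) (eq i)) (sym (insert-punchIn zero j ρ i)))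

------------------------------------------------------------------------
-- Linear discrepancy of monotone matrices

Matrix : Set → ℕ → ℕ → Set
Matrix A m n = Fin m → Fin n → A

_·_ : ∀ {m n} → Matrix ℝ m n → Vector ℝ n → Vector ℝ m
(A · v) i = Vector.foldr _+ᴿ_ 0ᴿ (λ j → A i j *ᴿ v j)

‖_‖∞ : ∀ {m} → Vector ℝ m → ℝ
‖ v ‖∞ = Vector.foldr _⊔ᴿ_ 0ᴿ (λ i → ∣ v i ∣ᴿ)

UnitCube : ℕ → Set
UnitCube n = Σ (Vector ℝ n) λ y → ∀ j → 0ᴿ ≤ᴿ y j × y j ≤ᴿ 1ᴿ

roundingError : ∀ {m n} → Matrix ℝ m n → Vector ℝ n → ℝ
roundingError {n = n} A y = overCube _⊓ᴿ_ 0ᴿ 1ᴿ n λ x →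
  ‖ (λ i → (A · lookup x) i -ᴿ (A · y) i) ‖∞

lindisc : ∀ {m n} → Matrix ℝ m n → LowerReal
lindisc {n = n} A = sup {UnitCube n} λ (y , _) → embed (roundingError A y)

record Monotone (k : ℕ) {m n : ℕ} (A : Matrix ℕ m n) : Set where
  field
    entries : ∀ i j → A i j ℕ.≤ k
    columns : ∀ i i′ j → i Fin.≤ i′ → A i j ℕ.≤ A i′ j

MonotoneMatrix : ℕ → ℕ → Set
MonotoneMatrix k n = Σ ℕ λ m → Σ (Matrix ℕ m n) (Monotone k)

Dᵐᵒⁿ : ℕ → ℕ → LowerReal
Dᵐᵒⁿ k n = sup {MonotoneMatrix k n} λ (_ , A , _) → lindisc (λ i j → fromℕ (A i j))

------------------------------------------------------------------------
-- Discrepancy of permutations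

SetSystem : ℕ → Set
SetSystem n = List (Subset n)

Colouring : ℕ → Set
Colouring n = Vec Sign n

-- s ◃ 1 is the integer ±1 of sign s.
χ-sum : ∀ {n} → Colouring n → Subset n → ℤ
χ-sum χ S = Vector.foldr ℤ._+_ 0ℤ λ i → if lookup S i then lookup χ i ◃ 1 else 0ℤ

disc : ∀ {n} → SetSystem n → ℕ
disc {n} 𝒮 = overCube ℕ._⊓_ Sign.+ Sign.- n λ χ →
  max 0 (List.map (λ S → ℤ.∣ χ-sum χ S ∣) 𝒮)

prefix : ∀ {n} → Permutation′ n → Fin n → Subset n
prefix {n} π j = ⋃ (List.map (λ l → ⁅ π ⟨$⟩ʳ l ⁆) (filter (Fin._≤? j) (allFin n)))

induced : ∀ {k n} → Vec (Permutation′ n) k → SetSystem n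
induced {n = n} πs = cartesianProductWith prefix (Vec.toList πs) (allFin n)

Dᵖᵉʳᵐ : ℕ → ℕ → ℕ
Dᵖᵉʳᵐ k n = max 0 (List.map (disc ∘ induced) (tuples (allPermutations n) k))

{-# OPTIONS --safe #-}
module Submission where

-- A column of a k-monotone matrix A is a sum of k zero-one columns, the t-th of which has
-- ones exactly in the rows i with t < A i j. For fixed t the zero-one rows form a chain of subsets of the
-- columns, hence are prefixes of one permutation; moving a set J of columns to the front, the traces
-- of the chain on J are prefixes as well. So all k levels, restricted to any J, have discrepancy
-- at most D = Dᵖᵉʳᵐ k n. As in the theorem of Lovász, Spencer and Vesztergombi, a dyadic point y is
-- then rounded bit by bit: colouring the coordinates whose last bit is set and moving them by ± that
-- bit costs 2⁻ᴸ D at bit L, and D altogether. Summing over the levels gives k D, and dyadic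
-- points approximate all others.

import Algebra.Properties.Semiring.Sum
open import Algebra.Bundles using (CommutativeRing)
open import Data.Bool.Base using (Bool; true; false; if_then_else_; _∧_)
open import Data.Bool.Properties using (∧-identityʳ; ∧-zeroʳ)
open import Data.Empty using (⊥-elim)
open import Data.Fin.Base as Fin using (Fin; zero; suc; toℕ; punchIn)
open import Data.Fin.Permutation as Perm
  using (Permutation′; _⟨$⟩ʳ_; _⟨$⟩ˡ_; inverseʳ; insert; insert-punchIn)
import Data.Fin.Properties as Fin
open import Data.Fin.Subset as Subset using (Subset; ⋃)
open import Data.Fin.Subset.Properties using (x∈⁅x⁆; x∈⁅y⁆⇒x≡y; x∈p∪q⁻; x∈p∪q⁺; ∉⊥)
open import Data.Integer.Base as ℤ using (ℤ; +_; 0ℤ; 1ℤ; _◃_)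
import Data.Integer.Properties as ℤ
import Data.Integer.Solver as ℤ
open import Data.List.Base as List using ([]; _∷_; allFin; filter)
open import Data.List.Extrema.Nat using (max; xs≤max)
import Data.List.Membership.Propositional as List
open import Data.List.Membership.Propositional.Properties
  using (∈-cartesianProductWith⁺; ∈-allFin; ∈-map⁺; ∈-filter⁺; ∈-filter⁻)
import Data.List.Relation.Unary.All as All
open import Data.List.Relation.Unary.Any using (here; there)
open import Data.Nat.Base as ℕ using (ℕ; zero; suc; NonZero; _*_; _≤_; _<_; z≤n; s≤s; ⌊_/2⌋; ⌈_/2⌉)
import Data.Nat.Properties as ℕ
import Data.Nat.Solver as ℕ
open import Data.Product.Base using (∃; _×_; _,_; proj₁; proj₂)
open import Data.Rational.Base as ℚ using (ℚ; mkℚ; 0ℚ; 1ℚ)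
import Data.Rational.Properties as ℚ
import Data.Rational.Solver as ℚ
import Data.Rational.Unnormalised.Base as ℚᵘ
import Data.Rational.Unnormalised.Properties as ℚᵘ
open import Data.Sign.Base as Sign using (Sign)
open import Data.Sum.Base using (_⊎_; inj₁; inj₂)
open import Data.Vec.Base as Vec using (Vec; []; _∷_; lookup; tabulate)
open import Data.Vec.Functional as Vector using (Vector)
open import Data.Vec.Membership.Propositional.Properties using (∈-lookup; ∈-toList⁺)
open import Data.Vec.Properties using ([]=⇒lookup; lookup⇒[]=; lookup∘tabulate)
open import Function.Base using (_∘_)
open import Function.Bundles using (_⇔_; mk⇔; Equivalence)
open import Relation.Binary.PropositionalEquality
open import Relation.Nullary using (Dec; yes; no; does; contradiction)
open import Relation.Nullary.Decidable using (dec-true; dec-false)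
open import Defs

open import Algebra.Properties.CommutativeSemigroup ℕ.*-commutativeSemigroup using (x∙yz≈y∙xz)
open Algebra.Properties.Semiring.Sum ℤ.+-*-semiring using (sum; sum-cong-≗; ∑-distrib-+; *-distribˡ-sum)
module ℚΣ = Algebra.Properties.Semiring.Sum (CommutativeRing.semiring ℚ.+-*-commutativeRing)

-- Sorting by keys and initial segments

argmin : ∀ {n} (κ : Fin (suc n) → ℕ) → ∃ λ j → ∀ i → κ j ≤ κ i
argmin {zero}  κ = zero , λ { zero → ℕ.≤-refl }
argmin {suc n} κ with argmin (κ ∘ suc)
... | j , h with ℕ.≤-total (κ zero) (κ (suc j))
...   | inj₁ p = zero , λ { zero → ℕ.≤-refl ; (suc i) → ℕ.≤-trans p (h i) }
...   | inj₂ p = suc j , λ { zero → p ; (suc i) → h i }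

Nondecreasing : ∀ {n} → (Fin n → ℕ) → Set
Nondecreasing f = ∀ i j → i Fin.≤ j → f i ≤ f j

-- Selection sort, with an index of least key put in front by `insert`. Built this way the
-- permutation is literally an element of `allPermutations`, whereas `allPermutations-complete`
-- yields only a pointwise equal one.
sorting : ∀ n (κ : Fin n → ℕ) →
          ∃ λ π → π List.∈ allPermutations n × Nondecreasing (κ ∘ (π ⟨$⟩ʳ_))
sorting zero    κ = Perm.id , here refl , λ ()
sorting (suc n) κ =
  let j , least = argmin κ
      ρ , ρ∈ , mono = sorting n (κ ∘ punchIn j)
      step = λ l → cong κ (insert-punchIn zero j ρ l)
  in insert zero j ρ
   , ∈-cartesianProductWith⁺ (insert zero) (∈-allFin j) ρ∈
   , λ { zero    _        _       → least _
       ; (suc l) (suc l′) (s≤s p) → subst₂ _≤_ (sym (step l)) (sym (step l′)) (mono l l′ p) }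

nondecreasing-tail : ∀ {n} {f : Fin (suc n) → ℕ} → Nondecreasing f → Nondecreasing (f ∘ suc)
nondecreasing-tail mono i j = mono (suc i) (suc j) ∘ s≤s

-- The positions with values at most `c` form an initial segment. The empty one is a separate case
-- because `prefix π l` always contains the image of `l`.
threshold : ∀ {n} (f : Fin n → ℕ) → Nondecreasing f → ∀ c →
            (∀ l → c < f l) ⊎ ∃ λ (l : Fin n) → ∀ l′ → f l′ ≤ c ⇔ l′ Fin.≤ l
threshold {zero}  f mono c = inj₁ λ ()
threshold {suc n} f mono c with ℕ.≤-<-connex (f zero) c
... | inj₂ c<f₀ = inj₁ λ l → ℕ.<-≤-trans c<f₀ (mono zero l z≤n)
... | inj₁ f₀≤c with threshold (f ∘ suc) (nondecreasing-tail mono) c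
...   | inj₁ above = inj₂ (zero , λ where
          zero     → mk⇔ (λ _ → z≤n) (λ _ → f₀≤c)
          (suc l′) → mk⇔ (λ p → contradiction p (ℕ.<⇒≱ (above l′))) (λ ()))
...   | inj₂ (l , h) = inj₂ (suc l , λ where
          zero     → mk⇔ (λ _ → z≤n) (λ _ → f₀≤c)
          (suc l′) → mk⇔ (s≤s ∘ Equivalence.to (h l′)) λ { (s≤s p) → Equivalence.from (h l′) p })

-- Membership in prefixes of a permutation

∈-⋃-map⁻ : ∀ {A : Set} {n} (f : A → Subset n) xs {i} → i Subset.∈ ⋃ (List.map f xs) →
           ∃ λ x → x List.∈ xs × i Subset.∈ f x
∈-⋃-map⁻ f []       i∈ = ⊥-elim (∉⊥ i∈)
∈-⋃-map⁻ f (x ∷ xs) i∈ with x∈p∪q⁻ (f x) _ i∈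
... | inj₁ p = x , here refl , p
... | inj₂ p = let y , y∈ , q = ∈-⋃-map⁻ f xs p in y , there y∈ , q

∈-⋃-map⁺ : ∀ {A : Set} {n} (f : A → Subset n) {xs x i} → x List.∈ xs → i Subset.∈ f x →
           i Subset.∈ ⋃ (List.map f xs)
∈-⋃-map⁺ f (here refl) p = x∈p∪q⁺ (inj₁ p)
∈-⋃-map⁺ f (there x∈)  p = x∈p∪q⁺ (inj₂ (∈-⋃-map⁺ f x∈ p))

∈-prefix⁻ : ∀ {n} (π : Permutation′ n) l {i} → i Subset.∈ prefix π l →
            ∃ λ l′ → l′ Fin.≤ l × i ≡ π ⟨$⟩ʳ l′
∈-prefix⁻ {n} π l i∈ =
  let l′ , l′∈ , p = ∈-⋃-map⁻ _ (filter (Fin._≤? l) (allFin n)) i∈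
  in l′ , proj₂ (∈-filter⁻ (Fin._≤? l) {xs = allFin n} l′∈) , x∈⁅y⁆⇒x≡y _ p

∈-prefix⁺ : ∀ {n} (π : Permutation′ n) {l l′} → l′ Fin.≤ l → π ⟨$⟩ʳ l′ Subset.∈ prefix π l
∈-prefix⁺ π {l} {l′} p =
  ∈-⋃-map⁺ _ (∈-filter⁺ (Fin._≤? l) (∈-allFin l′) p) (x∈⁅x⁆ _)

lookup-does : ∀ {n} (S : Subset n) i {P : Set} (P? : Dec P) → P ⇔ i Subset.∈ S →
              lookup S i ≡ does P?
lookup-does S i (yes p) eqv = []=⇒lookup (Equivalence.to eqv p)
lookup-does S i (no ¬p) eqv with lookup S i in eq
... | false = refl
... | true  = contradiction (Equivalence.from eqv (lookup⇒[]= i S eq)) ¬p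

-- Colourings that balance all prefixes at once

infix 7 _when_

_when_ : ℤ → Bool → ℤ
z when b = if b then z else 0ℤ

sum-zero : ∀ {n} (f : Vector ℤ n) → (∀ j → f j ≡ 0ℤ) → sum f ≡ 0ℤ
sum-zero {zero}  f h = refl
sum-zero {suc n} f h = cong₂ ℤ._+_ (h zero) (sum-zero (f ∘ suc) (h ∘ suc))

overCube-⊓-attained : {A : Set} (a b : A) → ∀ n (f : Vec A n → ℕ) →
                      ∃ λ v → f v ≡ overCube ℕ._⊓_ a b n f
overCube-⊓-attained a b zero    f = [] , refl
overCube-⊓-attained a b (suc n) f
  with overCube-⊓-attained a b n (f ∘ (a ∷_))
     | overCube-⊓-attained a b n (f ∘ (b ∷_))
     | ℕ.⊓-sel (overCube ℕ._⊓_ a b n (f ∘ (a ∷_))) (overCube ℕ._⊓_ a b n (f ∘ (b ∷_)))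
... | u , p | _     | inj₁ eq = a ∷ u , trans p (sym eq)
... | _     | v , q | inj₂ eq = b ∷ v , trans q (sym eq)

∈⇒≤max : ∀ {x xs} → x List.∈ xs → x ≤ max 0 xs
∈⇒≤max {xs = xs} = All.lookup (xs≤max 0 xs)

-- The discrepancy of this system is one of the numbers maximised in `Dᵖᵉʳᵐ k n`, and it is attained
-- by some colouring, which then serves all `k` permutations simultaneously.
permutation-colouring : ∀ {k n} (πs : Fin k → Permutation′ n) →
  (∀ t → πs t List.∈ allPermutations n) →
  ∃ λ (χ : Colouring n) → ∀ t l → ℤ.∣ χ-sum χ (prefix (πs t) l) ∣ ≤ Dᵖᵉʳᵐ k n
permutation-colouring {k} {n} πs πs∈ =
  let ps = tabulate πs
      ps∈ = tuples-complete (allPermutations n) ps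
              (λ t → subst (List._∈ allPermutations n) (sym (lookup∘tabulate πs t)) (πs∈ t))
      χ , eq = overCube-⊓-attained Sign.+ Sign.- n
                 (λ χ → max 0 (List.map (λ S → ℤ.∣ χ-sum χ S ∣) (induced ps)))
  in χ , λ t l → ℕ.≤-trans
       (∈⇒≤max (∈-map⁺ (λ S → ℤ.∣ χ-sum χ S ∣)
         (∈-cartesianProductWith⁺ prefix
           (subst (List._∈ Vec.toList ps) (lookup∘tabulate πs t) (∈-toList⁺ (∈-lookup t ps)))
           (∈-allFin l))))
       (ℕ.≤-trans (ℕ.≤-reflexive eq) (∈⇒≤max (∈-map⁺ (disc ∘ induced) ps∈)))

-- A key encodes a chain of column sets by its sublevel sets. Sorting the columns by the key turns
-- every nonempty sublevel set into a prefix of the sorting permutation; an empty one has sum 0.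
key-colouring : ∀ {k n} (κ : Fin k → Fin n → ℕ) →
  ∃ λ (χ : Colouring n) → ∀ t c →
    ℤ.∣ sum (λ j → (lookup χ j ◃ 1) when does (κ t j ℕ.≤? c)) ∣ ≤ Dᵖᵉʳᵐ k n
key-colouring {k} {n} κ = χ , bound
  where
  π : Fin k → Permutation′ n
  π t = proj₁ (sorting n (κ t))

  colouring = permutation-colouring π (λ t → proj₁ (proj₂ (sorting n (κ t))))
  χ = proj₁ colouring

  bound : ∀ t c → ℤ.∣ sum (λ j → (lookup χ j ◃ 1) when does (κ t j ℕ.≤? c)) ∣ ≤ Dᵖᵉʳᵐ k n
  bound t c with threshold _ (proj₂ (proj₂ (sorting n (κ t)))) c
  ... | inj₁ above = subst (λ z → ℤ.∣ z ∣ ≤ _) (sym (sum-zero _ outside)) z≤n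
    where
    outside : ∀ j → (lookup χ j ◃ 1) when does (κ t j ℕ.≤? c) ≡ 0ℤ
    outside j = cong ((lookup χ j ◃ 1) when_) (dec-false (κ t j ℕ.≤? c)
      (ℕ.<⇒≱ (subst (λ i → c < κ t i) (inverseʳ (π t)) (above (π t ⟨$⟩ˡ j)))))
  ... | inj₂ (l , h) = subst (λ z → ℤ.∣ z ∣ ≤ _)
      (sum-cong-≗ λ j → cong ((lookup χ j ◃ 1) when_)
        (lookup-does (prefix (π t) l) j (κ t j ℕ.≤? c) (mk⇔ (into j) (outof j))))
      (proj₂ colouring t l)
    where
    into : ∀ j → κ t j ≤ c → j Subset.∈ prefix (π t) l
    into j p = subst (Subset._∈ _) (inverseʳ (π t))
      (∈-prefix⁺ (π t) (Equivalence.to (h (π t ⟨$⟩ˡ j))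
        (subst (λ i → κ t i ≤ c) (sym (inverseʳ (π t))) p)))

    outof : ∀ j → j Subset.∈ prefix (π t) l → κ t j ≤ c
    outof j p with ∈-prefix⁻ (π t) l p
    ... | l′ , l′≤l , refl = Equivalence.from (h l′) l′≤l

-- The levels of a monotone matrix

firstAbove : ∀ {m} → ℕ → (Fin m → ℕ) → ℕ
firstAbove {zero}  t f = 0
firstAbove {suc m} t f = if t ℕ.<ᵇ f zero then 0 else suc (firstAbove t (f ∘ suc))

-- A nondecreasing column stays above `t` once it gets there, so row `i` of level `t` is the
-- sublevel set at `i` of the key `firstAbove t`. A column that never exceeds `t` has key `m`, which
-- no row index reaches.
firstAbove-spec : ∀ {m} t (f : Fin m → ℕ) → Nondecreasing f → ∀ i →
                  (t ℕ.<ᵇ f i) ≡ does (firstAbove t f ℕ.≤? toℕ i)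
firstAbove-spec t f mono zero with t ℕ.<ᵇ f zero
... | true  = refl
... | false = refl
firstAbove-spec t f mono (suc i) with t ℕ.<? f zero
... | yes t<f₀ rewrite dec-true (t ℕ.<? f zero) t<f₀ =
  dec-true (t ℕ.<? f (suc i)) (ℕ.<-≤-trans t<f₀ (mono zero (suc i) z≤n))
... | no  t≮f₀ rewrite dec-false (t ℕ.<? f zero) t≮f₀ =
  trans (firstAbove-spec t (f ∘ suc) (nondecreasing-tail mono) i) (sym (≤ᵇ-suc (firstAbove t (f ∘ suc)) (toℕ i)))
  where
  ≤ᵇ-suc : ∀ a b → (suc a ℕ.≤ᵇ suc b) ≡ (a ℕ.≤ᵇ b)
  ≤ᵇ-suc zero    b = refl
  ≤ᵇ-suc (suc a) b = refl

-- The hereditary discrepancy of the set system with these indicator rows is at most D.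
HereditarilyBalanced : ∀ {n} {I : Set} → (I → Fin n → Bool) → ℕ → Set
HereditarilyBalanced {n} rows D =
  (J : Fin n → Bool) → ∃ λ (χ : Colouring n) → ∀ i →
    ℤ.∣ sum (λ j → (lookup χ j ◃ 1) when (rows i j ∧ J j)) ∣ ≤ D

levels : ∀ {m n} k → Matrix ℕ m n → Fin k × Fin m → Fin n → Bool
levels k A (t , i) j = toℕ t ℕ.<ᵇ A i j

levels-balanced : ∀ {k m n} {A : Matrix ℕ m n} → Monotone k A →
                  HereditarilyBalanced (levels k A) (Dᵖᵉʳᵐ k n)
levels-balanced {k} {m} {n} {A} mon J =
  let χ , bound = key-colouring κ
  in χ , λ (t , i) → subst (λ z → ℤ.∣ z ∣ ≤ _)
       (sum-cong-≗ λ j → cong ((lookup χ j ◃ 1) when_) (κ-spec t i j)) (bound t (toℕ i))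
  where
  -- Columns outside J get the key m, above every row index, so they never enter a prefix in question.
  κ : Fin k → Fin n → ℕ
  κ t j = if J j then firstAbove (toℕ t) (λ i → A i j) else m

  κ-spec : ∀ t i j → does (κ t j ℕ.≤? toℕ i) ≡ levels k A (t , i) j ∧ J j
  κ-spec t i j with J j
  ... | true  = trans (sym (firstAbove-spec (toℕ t) (λ i → A i j) (λ i i′ → Monotone.columns mon i i′ j) i))
                      (sym (∧-identityʳ _))
  ... | false = trans (dec-false (m ℕ.≤? toℕ i) (ℕ.<⇒≱ (Fin.toℕ<n i))) (sym (∧-zeroʳ _))

-- Rounding dyadic points bit by bit

odd : ℕ → Bool
odd zero          = false
odd (suc zero)    = true
odd (suc (suc a)) = odd a

-- The colour of a coordinate decides in which direction an odd numerator is moved before halving;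
-- an even numerator is halved exactly.
halve : Sign → ℕ → ℕ
halve Sign.+ a = ⌈ a /2⌉
halve Sign.- a = ⌊ a /2⌋

halve-step : ∀ h a z → + 2 ℤ.* + h ≡ + a ℤ.+ z → + 2 ℤ.* + suc h ≡ + suc (suc a) ℤ.+ z
halve-step h a z eq = trans (ℤ.*-distribˡ-+ (+ 2) 1ℤ (+ h))
  (trans (cong (ℤ._+_ (+ 2)) eq) (sym (ℤ.+-assoc (+ 2) (+ a) z)))

halve-spec : ∀ s a → + 2 ℤ.* + halve s a ≡ + a ℤ.+ (s ◃ 1) when odd a
halve-spec Sign.+ zero          = refl
halve-spec Sign.- zero          = refl
halve-spec Sign.+ (suc zero)    = refl
halve-spec Sign.- (suc zero)    = refl
halve-spec Sign.+ (suc (suc a)) = halve-step ⌈ a /2⌉ a ((Sign.+ ◃ 1) when odd a) (halve-spec Sign.+ a)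
halve-spec Sign.- (suc (suc a)) = halve-step ⌊ a /2⌋ a ((Sign.- ◃ 1) when odd a) (halve-spec Sign.- a)

-- The bound `2 * b` is even, so even rounding up does not pass `b`: the point with halved
-- numerators stays in the unit cube.
halve-≤ : ∀ s {a} b → a ≤ 2 * b → halve s a ≤ b
halve-≤ Sign.- {a} b a≤ = ℕ.≤-trans (ℕ.⌊n/2⌋≤⌈n/2⌉ a) (halve-≤ Sign.+ b a≤)
halve-≤ Sign.+ {a} b a≤ = ℕ.≤-trans (ℕ.⌈n/2⌉-mono a≤)
  (ℕ.≤-reflexive (trans (cong (λ c → ⌈ b ℕ.+ c /2⌉) (ℕ.+-identityʳ b)) (sym (ℕ.n≡⌈n+n/2⌉ b))))

-- The rounding error `x j` - `a j` / `s`, multiplied by the denominator `s` to remain an integer.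
error : ∀ {n} → ℕ → (x a : Fin n → ℕ) → Fin n → ℤ
error s x a j = + s ℤ.* + x j ℤ.- + a j

-- With the summand D on the left the bound reads (2 ^ L − 1) D, which is what the induction needs.
dyadic-rounding : ∀ {n} {I : Set} {rows : I → Fin n → Bool} {D} → HereditarilyBalanced rows D →
  ∀ L (a : Fin n → ℕ) → (∀ j → a j ≤ 2 ℕ.^ L) →
  ∃ λ (x : Fin n → ℕ) → (∀ j → x j ≤ 1) ×
    ∀ i → ℤ.∣ sum (λ j → error (2 ℕ.^ L) x a j when rows i j) ∣ ℕ.+ D ≤ 2 ℕ.^ L * D
-- With denominator 1 the numerators are already 0 or 1, and the point is its own rounding.
dyadic-rounding {rows = rows} {D} bal zero a a≤ = a , a≤ , λ i →
  ℕ.≤-reflexive (trans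
    (cong (λ z → ℤ.∣ z ∣ ℕ.+ D) (sum-zero _ λ j → zero-error (rows i j) j))
    (sym (ℕ.*-identityˡ D)))
  where
  zero-error : ∀ b j → error 1 a a j when b ≡ 0ℤ
  zero-error false j = refl
  zero-error true  j = trans (cong (ℤ._- + a j) (ℤ.*-identityˡ (+ a j))) (ℤ.+-inverseʳ (+ a j))
dyadic-rounding {n} {rows = rows} {D} bal (suc L) a a≤ =
  let χ , small = bal (odd ∘ a)
      a′ = λ j → halve (lookup χ j) (a j)
      x , x≤1 , h = dyadic-rounding bal L a′ λ j → halve-≤ (lookup χ j) (2 ℕ.^ L) (a≤ j)
  in x , x≤1 , λ i → 
    let E = sum (λ j → error (2 ℕ.^ L) x a′ j when rows i j)
        C = sum (λ j → (lookup χ j ◃ 1) when (rows i j ∧ odd (a j)))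
    in bound E C (h i) (small i) (split χ x (rows i))
  where
  -- Coordinatewise, 2 ^ (L + 1) x - a = 2 (2 ^ L x - a′) + (2 a′ - a), where by `halve-spec` the
  -- last bracket is the colour if `a j` is odd and 0 otherwise.
  split : ∀ (χ : Colouring n) x (S : Fin n → Bool) →
    sum (λ j → error (2 ℕ.^ suc L) x a j when S j) ≡
    + 2 ℤ.* sum (λ j → error (2 ℕ.^ L) x (λ j → halve (lookup χ j) (a j)) j when S j)
      ℤ.+ sum (λ j → (lookup χ j ◃ 1) when (S j ∧ odd (a j)))
  split χ x S =
    trans (sum-cong-≗ λ j → term (S j) j)
      (trans (∑-distrib-+ (λ j → + 2 ℤ.* (error (2 ℕ.^ L) x a′ j when S j)) _)
        (cong (ℤ._+ sum (λ j → (lookup χ j ◃ 1) when (S j ∧ odd (a j))))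
          (sym (*-distribˡ-sum (+ 2) (λ j → error (2 ℕ.^ L) x a′ j when S j)))))
    where
    a′ = λ j → halve (lookup χ j) (a j)

    term : ∀ b j → error (2 ℕ.^ suc L) x a j when b ≡
      + 2 ℤ.* (error (2 ℕ.^ L) x a′ j when b) ℤ.+ (lookup χ j ◃ 1) when (b ∧ odd (a j))
    term false j = refl
    term true  j = trans
      (cong (λ z → z ℤ.* + x j ℤ.- + a j) (ℤ.pos-* 2 (2 ℕ.^ L)))
      (trans (solve 4 (λ p x a c → con (+ 2) :* p :* x :- a := con (+ 2) :* (p :* x) :- (a :+ c) :+ c)
          refl (+ (2 ℕ.^ L)) (+ x j) (+ a j) ((lookup χ j ◃ 1) when odd (a j)))
        (trans (cong (λ z → + 2 ℤ.* (+ (2 ℕ.^ L) ℤ.* + x j) ℤ.- z ℤ.+ (lookup χ j ◃ 1) when odd (a j))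
            (sym (halve-spec (lookup χ j) (a j))))
          (solve 4 (λ p x a c → con (+ 2) :* (p :* x) :- con (+ 2) :* a :+ c := con (+ 2) :* (p :* x :- a) :+ c)
            refl (+ (2 ℕ.^ L)) (+ x j) (+ a′ j) ((lookup χ j ◃ 1) when odd (a j)))))
      where open ℤ.+-*-Solver

  -- The cost D of the new bit and the summand D on the left add up to 2 D, so the whole bound
  -- doubles together with the denominator.
  bound : ∀ e c {z} → ℤ.∣ e ∣ ℕ.+ D ≤ 2 ℕ.^ L * D → ℤ.∣ c ∣ ≤ D → z ≡ + 2 ℤ.* e ℤ.+ c →
          ℤ.∣ z ∣ ℕ.+ D ≤ 2 ℕ.^ suc L * D
  bound e c p q refl = begin
    ℤ.∣ + 2 ℤ.* e ℤ.+ c ∣ ℕ.+ D          ≤⟨ ℕ.+-monoˡ-≤ D (ℤ.∣i+j∣≤∣i∣+∣j∣ (+ 2 ℤ.* e) c) ⟩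
    ℤ.∣ + 2 ℤ.* e ∣ ℕ.+ ℤ.∣ c ∣ ℕ.+ D      ≡⟨ cong (λ t → t ℕ.+ ℤ.∣ c ∣ ℕ.+ D) (ℤ.∣i*j∣≡∣i∣*∣j∣ (+ 2) e) ⟩
    2 * ℤ.∣ e ∣ ℕ.+ ℤ.∣ c ∣ ℕ.+ D         ≤⟨ ℕ.+-monoˡ-≤ D (ℕ.+-monoʳ-≤ (2 * ℤ.∣ e ∣) q) ⟩
    2 * ℤ.∣ e ∣ ℕ.+ D ℕ.+ D              ≡⟨ solve 2 (λ e d → con 2 :* e :+ d :+ d := con 2 :* (e :+ d)) refl ℤ.∣ e ∣ D ⟩
    2 * (ℤ.∣ e ∣ ℕ.+ D)                 ≤⟨ ℕ.*-monoʳ-≤ 2 p ⟩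
    2 * (2 ℕ.^ L * D)                   ≡⟨ sym (ℕ.*-assoc 2 (2 ℕ.^ L) D) ⟩
    2 ℕ.^ suc L * D                     ∎
    where open ℕ.≤-Reasoning
          open ℕ.+-*-Solver

-- From the levels back to the matrix

-- A number a ≤ k is the sum over t < k of the truth values of t < a.
level-sum : ∀ {n} k (a : Fin n → ℕ) (w : Fin n → ℤ) {E} → (∀ j → a j ≤ k) →
  (∀ (t : Fin k) → ℤ.∣ sum (λ j → w j when (toℕ t ℕ.<ᵇ a j)) ∣ ≤ E) →
  ℤ.∣ sum (λ j → + a j ℤ.* w j) ∣ ≤ k * E
level-sum zero    a w a≤k h =
  ℕ.≤-reflexive (cong ℤ.∣_∣ (sum-zero _ λ j → cong (λ b → + b ℤ.* w j) (ℕ.n≤0⇒n≡0 (a≤k j))))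
level-sum (suc k) a w {E} a≤k h = ℕ.≤-trans
  (ℕ.≤-reflexive (cong ℤ.∣_∣ (trans (sum-cong-≗ λ j → peel (a j) (w j)) (∑-distrib-+ W R))))
  (ℕ.≤-trans (ℤ.∣i+j∣≤∣i∣+∣j∣ (sum W) (sum R))
    -- Level 0 is split off; the remaining levels of `a` are the levels of its predecessor.
    (ℕ.+-mono-≤ (h zero) (level-sum k (ℕ.pred ∘ a) w (λ j → ℕ.pred-mono-≤ (a≤k j)) λ t →
      subst (λ z → ℤ.∣ z ∣ ≤ E) (sum-cong-≗ λ j → cong (w j when_) (shift (toℕ t) (a j))) (h (suc t)))))
  where
  W = λ j → w j when (0 ℕ.<ᵇ a j)
  R = λ j → + ℕ.pred (a j) ℤ.* w j

  peel : ∀ b z → + b ℤ.* z ≡ z when (0 ℕ.<ᵇ b) ℤ.+ + ℕ.pred b ℤ.* z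
  peel zero    z = refl
  peel (suc b) z = ℤ.suc-* (+ b) z

  shift : ∀ t b → (suc t ℕ.<ᵇ b) ≡ (t ℕ.<ᵇ ℕ.pred b)
  shift t zero    = refl
  shift t (suc b) = refl

-- One `x` rounds all levels of all rows with error at most 2 ^ L D each, and an entry is the sum of
-- its `k` levels.
matrix-rounding : ∀ {k m n} {A : Matrix ℕ m n} → Monotone k A →
  ∀ L (a : Fin n → ℕ) → (∀ j → a j ≤ 2 ℕ.^ L) →
  ∃ λ (x : Fin n → ℕ) → (∀ j → x j ≤ 1) ×
    ∀ i → ℤ.∣ sum (λ j → + A i j ℤ.* error (2 ℕ.^ L) x a j) ∣ ≤ k * (2 ℕ.^ L * Dᵖᵉʳᵐ k n)
matrix-rounding {k} {n = n} {A} mon L a a≤ =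
  let x , x≤1 , h = dyadic-rounding (levels-balanced mon) L a a≤
  in x , x≤1 , λ i → level-sum k (A i) (error (2 ℕ.^ L) x a) (Monotone.entries mon i)
       λ t → ℕ.≤-trans (ℕ.m≤m+n _ (Dᵖᵉʳᵐ k n)) (h (t , i))

-- The embedding of the integers in the rationals

ι : ℤ → ℚ
ι z = z ℚ./ 1

toℚᵘ-ι : ∀ z → ℚ.toℚᵘ (ι z) ℚᵘ.≃ ℚᵘ.mkℚᵘ z 0
toℚᵘ-ι z = ℚ.toℚᵘ-fromℚᵘ (ℚᵘ.mkℚᵘ z 0)

-- Reduction to lowest terms does not compute on a variable `z`. Identities for `ι` are therefore
-- checked on unnormalised fractions, where they become integer identities.
ι-unique : ∀ z {q} → ℚ.toℚᵘ q ℚᵘ.≃ ℚᵘ.mkℚᵘ z 0 → ι z ≡ q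
ι-unique z eq = ℚ.toℚᵘ-injective (ℚᵘ.≃-trans (toℚᵘ-ι z) (ℚᵘ.≃-sym eq))

ι-+ : ∀ a b → ι (a ℤ.+ b) ≡ ι a ℚ.+ ι b
ι-+ a b = ι-unique (a ℤ.+ b) (ℚᵘ.≃-trans (ℚ.toℚᵘ-homo-+ (ι a) (ι b))
  (ℚᵘ.≃-trans (ℚᵘ.+-cong (toℚᵘ-ι a) (toℚᵘ-ι b))
    (ℚᵘ.*≡* (solve 2 (λ a b → (a :* con 1ℤ :+ b :* con 1ℤ) :* con 1ℤ := (a :+ b) :* con 1ℤ) refl a b))))
  where open ℤ.+-*-Solver

ι-* : ∀ a b → ι (a ℤ.* b) ≡ ι a ℚ.* ι b
ι-* a b = ι-unique (a ℤ.* b) (ℚᵘ.≃-trans (ℚ.toℚᵘ-homo-* (ι a) (ι b)) (ℚᵘ.*-cong (toℚᵘ-ι a) (toℚᵘ-ι b)))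

ι-neg : ∀ a → ι (ℤ.- a) ≡ ℚ.- ι a
ι-neg a = ι-unique (ℤ.- a) (ℚᵘ.≃-trans (ℚ.toℚᵘ-homo‿- (ι a)) (ℚᵘ.-‿cong (toℚᵘ-ι a)))

ι-∣-∣ : ∀ a → ι (+ ℤ.∣ a ∣) ≡ ℚ.∣ ι a ∣
ι-∣-∣ a = ι-unique (+ ℤ.∣ a ∣) (ℚᵘ.≃-trans (ℚ.toℚᵘ-homo-∣-∣ (ι a)) (ℚᵘ.∣-∣-cong (toℚᵘ-ι a)))

ι-mono-≤ : ∀ {a b} → a ℤ.≤ b → ι a ℚ.≤ ι b
ι-mono-≤ {a} {b} a≤b = ℚ.toℚᵘ-cancel-≤
  (ℚᵘ.≤-respˡ-≃ (ℚᵘ.≃-sym (toℚᵘ-ι a)) (ℚᵘ.≤-respʳ-≃ (ℚᵘ.≃-sym (toℚᵘ-ι b))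
    (ℚᵘ.*≤* (ℤ.*-monoʳ-≤-nonNeg 1ℤ a≤b))))

-- Approximation by dyadic numerators

n≤2^n : ∀ n → n ≤ 2 ℕ.^ n
n≤2^n zero    = z≤n
n≤2^n (suc n) = ℕ.+-mono-≤ (ℕ.m^n>0 2 n) (ℕ.≤-trans (n≤2^n n) (ℕ.m≤m+n _ 0))

-- With q the denominator of δ, 2^q ≥ q.
archimedean : ∀ δ → 0ℚ ℚ.< δ → ∃ λ L → 1ℚ ℚ.≤ ι (+ (2 ℕ.^ L)) ℚ.* δ
archimedean δ@(mkℚ (+ suc p) q _) 0<δ = suc q , ℚ.toℚᵘ-cancel-≤
  (ℚᵘ.≤-respʳ-≃ (ℚᵘ.≃-sym (ℚᵘ.≃-trans (ℚ.toℚᵘ-homo-* (ι (+ (2 ℕ.^ suc q))) δ)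
      (ℚᵘ.*-congʳ (toℚᵘ-ι (+ (2 ℕ.^ suc q))))))
    (ℚᵘ.*≤* (subst₂ ℤ._≤_
      (sym (trans (ℤ.*-identityˡ (+ (suc q ℕ.+ 0))) (cong +_ (ℕ.+-identityʳ (suc q)))))
      (sym (trans (ℤ.*-identityʳ _) (sym (ℤ.pos-* (2 ℕ.^ suc q) (suc p)))))
      (ℤ.+≤+ (ℕ.≤-trans (n≤2^n (suc q)) (ℕ.m≤m*n (2 ℕ.^ suc q) (suc p)))))))
archimedean (mkℚ (+ zero)   _ _) (ℚ.*<* (ℤ.+<+ ()))
archimedean (mkℚ ℤ.-[1+ _ ] _ _) (ℚ.*<* ())

∣a-b∣≤c : ∀ a b {c} → a ℚ.≤ b ℚ.+ c → b ℚ.≤ a ℚ.+ c → ℚ.∣ a ℚ.- b ∣ ℚ.≤ c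
∣a-b∣≤c a b {c} a≤b+c b≤a+c with ℚ.∣p∣≡p∨∣p∣≡-p (a ℚ.- b)
... | inj₁ eq = subst (ℚ._≤ c) (sym eq)
  (subst (a ℚ.- b ℚ.≤_) (solve 2 (λ b c → (b :+ c) :- b := c) refl b c) (ℚ.+-monoˡ-≤ (ℚ.- b) a≤b+c))
  where open ℚ.+-*-Solver
... | inj₂ eq = subst (ℚ._≤ c) (sym (trans eq (solve 2 (λ a b → :- (a :- b) := b :- a) refl a b)))
  (subst (b ℚ.- a ℚ.≤_) (solve 2 (λ b c → (b :+ c) :- b := c) refl a c) (ℚ.+-monoˡ-≤ (ℚ.- a) b≤a+c))
  where open ℚ.+-*-Solver

-- y is only known to lie within δ of [0, M]: approximations of a real in an interval may leave it.
nearest : ∀ M y {δ} → 1ℚ ℚ.≤ δ → 0ℚ ℚ.≤ y ℚ.+ δ → y ℚ.≤ ι (+ M) ℚ.+ δ →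
          ∃ λ a → a ≤ M × ℚ.∣ ι (+ a) ℚ.- y ∣ ℚ.≤ δ
nearest zero    y     1≤δ lo hi = 0 , z≤n , ∣a-b∣≤c 0ℚ y lo hi
nearest (suc M) y {δ} 1≤δ lo hi with y ℚ.≤? ι (+ M) ℚ.+ δ
... | yes y≤ = let a , a≤M , h = nearest M y 1≤δ lo y≤ in a , ℕ.m≤n⇒m≤1+n a≤M , h
-- Here `y` lies above M + δ, hence above M + 1 because 1 ≤ δ, while `hi` keeps it within δ of M +
-- 1.
... | no  y≰ = suc M , ℕ.≤-refl , ∣a-b∣≤c (ι (+ suc M)) y above hi
  where
  open ℚ.≤-Reasoning
  above : ι (+ suc M) ℚ.≤ y ℚ.+ δ
  above = begin
    ι (+ suc M)        ≡⟨ ι-+ 1ℤ (+ M) ⟩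
    1ℚ ℚ.+ ι (+ M)     ≤⟨ ℚ.+-monoˡ-≤ (ι (+ M)) 1≤δ ⟩
    δ ℚ.+ ι (+ M)      ≡⟨ ℚ.+-comm δ (ι (+ M)) ⟩
    ι (+ M) ℚ.+ δ      ≤⟨ ℚ.<⇒≤ (ℚ.≰⇒> y≰) ⟩
    y                  ≡⟨ sym (ℚ.+-identityʳ y) ⟩
    y ℚ.+ 0ℚ           ≤⟨ ℚ.+-monoʳ-≤ y (ℚ.≤-trans (ℚ.*≤* (ℤ.+≤+ z≤n)) 1≤δ) ⟩
    y ℚ.+ δ            ∎

-- Rounding rational points near the cube

ι-sum : ∀ {n} (f : Fin n → ℤ) → ι (sum f) ≡ ℚΣ.sum (ι ∘ f)
ι-sum {zero}  f = refl
ι-sum {suc n} f = trans (ι-+ (f zero) (sum (f ∘ suc))) (cong (ι (f zero) ℚ.+_) (ι-sum (f ∘ suc)))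

∣sum∣≤ : ∀ {n} (f : Fin n → ℚ) {c} → (∀ j → ℚ.∣ f j ∣ ℚ.≤ c) → ℚ.∣ ℚΣ.sum f ∣ ℚ.≤ ι (+ n) ℚ.* c
∣sum∣≤ {zero}  f {c} h = ℚ.≤-reflexive (sym (ℚ.*-zeroˡ c))
∣sum∣≤ {suc n} f {c} h = begin
  ℚ.∣ f zero ℚ.+ ℚΣ.sum (f ∘ suc) ∣           ≤⟨ ℚ.∣p+q∣≤∣p∣+∣q∣ (f zero) (ℚΣ.sum (f ∘ suc)) ⟩
  ℚ.∣ f zero ∣ ℚ.+ ℚ.∣ ℚΣ.sum (f ∘ suc) ∣      ≤⟨ ℚ.+-mono-≤ (h zero) (∣sum∣≤ (f ∘ suc) (h ∘ suc)) ⟩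
  c ℚ.+ ι (+ n) ℚ.* c                       ≡⟨ solve 2 (λ c n → c :+ n :* c := (con 1ℚ :+ n) :* c) refl c (ι (+ n)) ⟩
  (1ℚ ℚ.+ ι (+ n)) ℚ.* c                    ≡⟨ cong (ℚ._* c) (sym (ι-+ 1ℤ (+ n))) ⟩
  ι (+ suc n) ℚ.* c                         ∎
  where open ℚ.≤-Reasoning
        open ℚ.+-*-Solver

0≤ι : ∀ n → 0ℚ ℚ.≤ ι (+ n)
0≤ι n = ι-mono-≤ {0ℤ} {+ n} (ℤ.+≤+ z≤n)

ι-pos : ∀ n → .{{NonZero n}} → ℚ.Positive (ι (+ n))
ι-pos n = ℚ.normalize-pos n 1

-- P (x - y) = (P x - a) + (a - P y). The first part is the integer error, contributing at most P k
-- D in total; the second is the approximation of `y`, contributing at most k P δ per coordinate.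
-- Finally P is cancelled.
rescale : ∀ {n} k P D .{{_ : NonZero P}} (b x a : Fin n → ℕ) (y : Fin n → ℚ) {δ} →
  (∀ j → b j ≤ k) →
  (∀ j → ℚ.∣ ι (+ a j) ℚ.- ι (+ P) ℚ.* y j ∣ ℚ.≤ ι (+ P) ℚ.* δ) →
  ℤ.∣ sum (λ j → + b j ℤ.* error P x a j) ∣ ≤ k * (P * D) →
  ℚ.∣ ℚΣ.sum (λ j → ι (+ b j) ℚ.* (ι (+ x j) ℚ.- y j)) ∣ ℚ.≤ ι (+ (k * D)) ℚ.+ ι (+ (n * k)) ℚ.* δ
rescale {n} k P D b x a y {δ} b≤k near small = ℚ.*-cancelˡ-≤-pos p {{ι-pos P}} scaled
  where
  p = ι (+ P)

  open ℚ.≤-Reasoning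
  open ℚ.+-*-Solver

  main rest : Fin n → ℚ
  main j = ι (+ b j ℤ.* error P x a j)
  rest j = ι (+ b j) ℚ.* (ι (+ a j) ℚ.- p ℚ.* y j)

  ι-error : ∀ j → ι (error P x a j) ≡ p ℚ.* ι (+ x j) ℚ.- ι (+ a j)
  ι-error j = trans (ι-+ (+ P ℤ.* + x j) (ℤ.- + a j)) (cong₂ ℚ._+_ (ι-* (+ P) (+ x j)) (ι-neg (+ a j)))

  split : ∀ j → p ℚ.* (ι (+ b j) ℚ.* (ι (+ x j) ℚ.- y j)) ≡ main j ℚ.+ rest j
  split j = begin-equality
    p ℚ.* (ι (+ b j) ℚ.* (ι (+ x j) ℚ.- y j))
      ≡⟨ solve 5 (λ p A x y a → p :* (A :* (x :- y)) := A :* (p :* x :- a) :+ A :* (a :- p :* y))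
           refl p (ι (+ b j)) (ι (+ x j)) (y j) (ι (+ a j)) ⟩
    ι (+ b j) ℚ.* (p ℚ.* ι (+ x j) ℚ.- ι (+ a j)) ℚ.+ rest j
      ≡⟨ cong (λ t → ι (+ b j) ℚ.* t ℚ.+ rest j) (sym (ι-error j)) ⟩
    ι (+ b j) ℚ.* ι (error P x a j) ℚ.+ rest j
      ≡⟨ cong (ℚ._+ rest j) (sym (ι-* (+ b j) (error P x a j))) ⟩
    main j ℚ.+ rest j ∎

  main-bound : ℚ.∣ ℚΣ.sum main ∣ ℚ.≤ p ℚ.* ι (+ (k * D))
  main-bound = begin
    ℚ.∣ ℚΣ.sum main ∣               ≡⟨ cong ℚ.∣_∣ (sym (ι-sum (λ j → + b j ℤ.* error P x a j))) ⟩
    ℚ.∣ ι z ∣                           ≡⟨ sym (ι-∣-∣ z) ⟩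
    ι (+ ℤ.∣ z ∣)                       ≤⟨ ι-mono-≤ (ℤ.+≤+ small) ⟩
    ι (+ (k * (P * D)))                 ≡⟨ cong (ι ∘ +_) (x∙yz≈y∙xz k P D) ⟩
    ι (+ (P * (k * D)))                 ≡⟨ cong ι (ℤ.pos-* P (k * D)) ⟩
    ι (+ P ℤ.* + (k * D))               ≡⟨ ι-* (+ P) (+ (k * D)) ⟩
    p ℚ.* ι (+ (k * D))                 ∎
    where
    z = sum (λ j → + b j ℤ.* error P x a j)

  rest-term : ∀ j → ℚ.∣ rest j ∣ ℚ.≤ ι (+ k) ℚ.* (p ℚ.* δ)
  rest-term j = begin
    ℚ.∣ rest j ∣                          ≡⟨ ℚ.∣p*q∣≡∣p∣*∣q∣ (ι (+ b j)) e ⟩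
    ℚ.∣ ι (+ b j) ∣ ℚ.* ℚ.∣ e ∣            ≡⟨ cong (ℚ._* ℚ.∣ e ∣) (ℚ.0≤p⇒∣p∣≡p (0≤ι (b j))) ⟩
    ι (+ b j) ℚ.* ℚ.∣ e ∣                 ≤⟨ ℚ.*-monoʳ-≤-nonNeg ℚ.∣ e ∣ {{ℚ.∣-∣-nonNeg e}} (ι-mono-≤ (ℤ.+≤+ (b≤k j))) ⟩
    ι (+ k) ℚ.* ℚ.∣ e ∣                     ≤⟨ ℚ.*-monoˡ-≤-nonNeg (ι (+ k)) {{ℚ.nonNegative (0≤ι k)}} (near j) ⟩
    ι (+ k) ℚ.* (p ℚ.* δ)                   ∎
    where e = ι (+ a j) ℚ.- p ℚ.* y j

  scaled : p ℚ.* ℚ.∣ ℚΣ.sum (λ j → ι (+ b j) ℚ.* (ι (+ x j) ℚ.- y j)) ∣ ℚ.≤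
                 p ℚ.* (ι (+ (k * D)) ℚ.+ ι (+ (n * k)) ℚ.* δ)
  scaled = begin
    p ℚ.* ℚ.∣ ℚΣ.sum f ∣                         ≡⟨ cong (ℚ._* ℚ.∣ ℚΣ.sum f ∣) (sym (ℚ.0≤p⇒∣p∣≡p (0≤ι P))) ⟩
    ℚ.∣ p ∣ ℚ.* ℚ.∣ ℚΣ.sum f ∣                   ≡⟨ sym (ℚ.∣p*q∣≡∣p∣*∣q∣ p (ℚΣ.sum f)) ⟩
    ℚ.∣ p ℚ.* ℚΣ.sum f ∣                         ≡⟨ cong ℚ.∣_∣ (ℚΣ.*-distribˡ-sum p f) ⟩
    ℚ.∣ ℚΣ.sum (λ j → p ℚ.* f j) ∣               ≡⟨ cong ℚ.∣_∣ (ℚΣ.sum-cong-≗ split) ⟩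
    ℚ.∣ ℚΣ.sum (λ j → main j ℚ.+ rest j) ∣    ≡⟨ cong ℚ.∣_∣ (ℚΣ.∑-distrib-+ main rest) ⟩
    ℚ.∣ ℚΣ.sum main ℚ.+ ℚΣ.sum rest ∣     ≤⟨ ℚ.∣p+q∣≤∣p∣+∣q∣ (ℚΣ.sum main) (ℚΣ.sum rest) ⟩
    ℚ.∣ ℚΣ.sum main ∣ ℚ.+ ℚ.∣ ℚΣ.sum rest ∣
      ≤⟨ ℚ.+-mono-≤ (main-bound) (∣sum∣≤ rest rest-term) ⟩
    p ℚ.* ι (+ (k * D)) ℚ.+ ι (+ n) ℚ.* (ι (+ k) ℚ.* (p ℚ.* δ))
      ≡⟨ solve 5 (λ p b n k δ → p :* b :+ n :* (k :* (p :* δ)) := p :* (b :+ n :* k :* δ))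
           refl p (ι (+ (k * D))) (ι (+ n)) (ι (+ k)) δ ⟩
    p ℚ.* (ι (+ (k * D)) ℚ.+ ι (+ n) ℚ.* ι (+ k) ℚ.* δ)
      ≡⟨ cong (λ c → p ℚ.* (ι (+ (k * D)) ℚ.+ c ℚ.* δ)) (sym (trans (cong ι (ℤ.pos-* n k)) (ι-* (+ n) (+ k)))) ⟩
    p ℚ.* (ι (+ (k * D)) ℚ.+ ι (+ (n * k)) ℚ.* δ) ∎
    where f = λ j → ι (+ b j) ℚ.* (ι (+ x j) ℚ.- y j)

rational-rounding : ∀ {k m n} {A : Matrix ℕ m n} → Monotone k A → ∀ {δ} → 0ℚ ℚ.< δ →
  (y : Fin n → ℚ) → (∀ j → 0ℚ ℚ.≤ y j ℚ.+ δ × y j ℚ.≤ 1ℚ ℚ.+ δ) →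
  ∃ λ (x : Fin n → ℕ) → (∀ j → x j ≤ 1) ×
    ∀ i → ℚ.∣ ℚΣ.sum (λ j → ι (+ A i j) ℚ.* (ι (+ x j) ℚ.- y j)) ∣
            ℚ.≤ ι (+ (k * Dᵖᵉʳᵐ k n)) ℚ.+ ι (+ (n * k)) ℚ.* δ
rational-rounding {k} {n = n} {A} mon {δ} 0<δ y y∈ =
  -- The grid of step 2 ^ (-L) ≤ δ in [0, 1] has a point within δ of each `y j`; multiplied by 2 ^
  -- L, this is the situation of `nearest`.
  let L , 1≤pδ = archimedean δ 0<δ
      approximation = λ j → scaled-nearest (2 ℕ.^ L) (y j) 1≤pδ (proj₁ (y∈ j)) (proj₂ (y∈ j))
      a = proj₁ ∘ approximation
      x , x≤1 , h = matrix-rounding mon L a (proj₁ ∘ proj₂ ∘ approximation)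
  in x , x≤1 , λ i → rescale k (2 ℕ.^ L) (Dᵖᵉʳᵐ k n) {{ℕ.m^n≢0 2 L}} (A i) x a y
       (Monotone.entries mon i) (proj₂ ∘ proj₂ ∘ approximation) (h i)
  where
  scaled-nearest : ∀ P z → 1ℚ ℚ.≤ ι (+ P) ℚ.* δ → 0ℚ ℚ.≤ z ℚ.+ δ → z ℚ.≤ 1ℚ ℚ.+ δ →
    ∃ λ a → a ≤ P × ℚ.∣ ι (+ a) ℚ.- ι (+ P) ℚ.* z ∣ ℚ.≤ ι (+ P) ℚ.* δ
  scaled-nearest P z 1≤pδ lo hi = nearest P (p ℚ.* z) 1≤pδ
    (subst₂ ℚ._≤_ (ℚ.*-zeroʳ p) (ℚ.*-distribˡ-+ p z δ) (ℚ.*-monoˡ-≤-nonNeg p lo))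
    (subst (p ℚ.* z ℚ.≤_) (trans (ℚ.*-distribˡ-+ p 1ℚ δ) (cong (ℚ._+ p ℚ.* δ) (ℚ.*-identityʳ p)))
      (ℚ.*-monoˡ-≤-nonNeg p hi))
    where
    p = ι (+ P)
    instance
      p-nonNeg : ℚ.NonNegative p
      p-nonNeg = ℚ.nonNegative (0≤ι P)

-- Terms of the Cauchy sequences of real expressions

seq-sum : ∀ {n} (f : Vector ℝ n) N →
          seq (Vector.foldr _+ᴿ_ 0ᴿ f) N ≡ ℚΣ.sum (λ j → seq (f j) N)
seq-sum {zero}  f N = refl
seq-sum {suc n} f N = cong (seq (f zero) N ℚ.+_) (seq-sum (f ∘ suc) N)

-- The fold starts at `0ᴿ`, whence the hypothesis that `c` is nonnegative.
seq-‖‖∞≤ : ∀ {m} (v : Vector ℝ m) N {c} → 0ℚ ℚ.≤ c → (∀ i → ℚ.∣ seq (v i) N ∣ ℚ.≤ c) →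
           seq ‖ v ‖∞ N ℚ.≤ c
seq-‖‖∞≤ {zero}  v N 0≤c h = 0≤c
seq-‖‖∞≤ {suc m} v N 0≤c h =
  ℚ.⊔-lub {_} {ℚ.∣ seq (v zero) N ∣} {seq ‖ v ∘ suc ‖∞ N} (h zero) (seq-‖‖∞≤ (v ∘ suc) N 0≤c (h ∘ suc))

-- A minimum is at most the value at any vertex, and `x` directs the descent to one. The vertex is
-- passed to the hypothesis through its `N`-th terms, which suffice for an estimate at index `N`.
overCube-⊓ᴿ-≤ : ∀ n (f : Vec ℝ n → ℝ) (x : Fin n → ℕ) → (∀ j → x j ≤ 1) → ∀ N {c} →
  (∀ v → (∀ j → seq (lookup v j) N ≡ ι (+ x j)) → seq (f v) N ℚ.≤ c) →
  seq (overCube _⊓ᴿ_ 0ᴿ 1ᴿ n f) N ℚ.≤ c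
overCube-⊓ᴿ-≤ zero    f x x≤1 N h = h [] λ ()
overCube-⊓ᴿ-≤ (suc n) f x x≤1 N {c} h = by-head (x zero) refl (x≤1 zero)
  where
  value : ℝ → ℚ
  value r = seq (overCube _⊓ᴿ_ 0ᴿ 1ᴿ n (f ∘ (r ∷_))) N

  value-≤ : ∀ r → seq r N ≡ ι (+ x zero) → value r ℚ.≤ c
  value-≤ r r≡ = overCube-⊓ᴿ-≤ n (f ∘ (r ∷_)) (x ∘ suc) (x≤1 ∘ suc) N λ v v≡ →
    h (r ∷ v) λ { zero → r≡ ; (suc j) → v≡ j }

  by-head : ∀ b → x zero ≡ b → b ≤ 1 → value 0ᴿ ℚ.⊓ value 1ᴿ ℚ.≤ c
  by-head 0 eq _ = ℚ.≤-trans (ℚ.p⊓q≤p (value 0ᴿ) (value 1ᴿ)) (value-≤ 0ᴿ (cong (ι ∘ +_) (sym eq)))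
  by-head 1 eq _ = ℚ.≤-trans (ℚ.p⊓q≤q (value 0ᴿ) (value 1ᴿ)) (value-≤ 1ᴿ (cong (ι ∘ +_) (sym eq)))
  by-head (suc (suc _)) _ (s≤s ())

eventually-all : ∀ {n} {P : Fin n → ℕ → Set} → (∀ j → ∃ λ N → ∀ l → N ≤ l → P j l) →
                 ∃ λ N → ∀ l → N ≤ l → ∀ j → P j l
eventually-all {zero}  h = 0 , λ _ _ ()
eventually-all {suc n} h =
  let M , p = h zero
      N , q = eventually-all (h ∘ suc)
  in M ℕ.⊔ N , λ l M⊔N≤l → λ where
       zero    → p l (ℕ.m⊔n≤o⇒m≤o M N M⊔N≤l)
       (suc j) → q l (ℕ.m⊔n≤o⇒n≤o M N M⊔N≤l) j

sum-distrib-- : ∀ {n} (f g : Fin n → ℚ) → ℚΣ.sum f ℚ.- ℚΣ.sum g ≡ ℚΣ.sum (λ j → f j ℚ.- g j)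
sum-distrib-- {zero}  f g = refl
sum-distrib-- {suc n} f g = trans
  (solve 4 (λ a b c d → (a :+ b) :- (c :+ d) := (a :- c) :+ (b :- d)) refl
    (f zero) (ℚΣ.sum (f ∘ suc)) (g zero) (ℚΣ.sum (g ∘ suc)))
  (cong (f zero ℚ.- g zero ℚ.+_) (sum-distrib-- (f ∘ suc) (g ∘ suc)))
  where open ℚ.+-*-Solver

seq-· : ∀ {m n} (A : Matrix ℝ m n) (v : Vector ℝ n) i N →
        seq ((A · v) i) N ≡ ℚΣ.sum (λ j → seq (A i j) N ℚ.* seq (v j) N)
seq-· A v i N = seq-sum (λ j → A i j *ᴿ v j) N

seq-error : ∀ {m n} (A : Matrix ℝ m n) (x y : Vector ℝ n) i N {u : Fin n → ℚ} →
  (∀ j → seq (x j) N ≡ u j) →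
  seq ((A · x) i -ᴿ (A · y) i) N ≡ ℚΣ.sum (λ j → seq (A i j) N ℚ.* (u j ℚ.- seq (y j) N))
seq-error A x y i N {u} x≡u = trans
  (cong₂ (λ p q → p ℚ.- q) (seq-· A x i N) (seq-· A y i N))
  (trans (sum-distrib-- (λ j → seq (A i j) N ℚ.* seq (x j) N) (λ j → seq (A i j) N ℚ.* seq (y j) N))
    (ℚΣ.sum-cong-≗ λ j → trans
      (factor (seq (A i j) N) (seq (x j) N) (seq (y j) N))
      (cong (λ q → seq (A i j) N ℚ.* (q ℚ.- seq (y j) N)) (x≡u j))))
  where
  factor : ∀ a x y → a ℚ.* x ℚ.- a ℚ.* y ≡ a ℚ.* (x ℚ.- y)
  factor = solve 3 (λ a x y → a :* x :- a :* y := a :* (x :- y)) refl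
    where open ℚ.+-*-Solver

seq-roundingError-≤ : ∀ {m n} (A : Matrix ℝ m n) y (x : Fin n → ℕ) → (∀ j → x j ≤ 1) →
  ∀ N {c} → 0ℚ ℚ.≤ c →
  (∀ i → ℚ.∣ ℚΣ.sum (λ j → seq (A i j) N ℚ.* (ι (+ x j) ℚ.- seq (y j) N)) ∣ ℚ.≤ c) →
  seq (roundingError A y) N ℚ.≤ c
seq-roundingError-≤ {n = n} A y x x≤1 N {c} 0≤c h =
  overCube-⊓ᴿ-≤ n (λ v → ‖ (λ i → (A · lookup v) i -ᴿ (A · y) i) ‖∞) x x≤1 N λ v v≡x →
    seq-‖‖∞≤ (λ i → (A · lookup v) i -ᴿ (A · y) i) N 0≤c λ i →
      subst (λ q → ℚ.∣ q ∣ ℚ.≤ c) (sym (seq-error A (lookup v) y i N v≡x)) (h i)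

-- Real points and the supremum

divide : ∀ c {ε} → .{{ℚ.Positive c}} → 0ℚ ℚ.< ε → ∃ λ δ → 0ℚ ℚ.< δ × c ℚ.* δ ≡ ε
divide c {ε} 0<ε = c⁻¹ ℚ.* ε
  , subst (ℚ._< c⁻¹ ℚ.* ε) (ℚ.*-zeroʳ c⁻¹) (ℚ.*-monoʳ-<-pos c⁻¹ {{ℚ.1/pos⇒pos c}} 0<ε)
  , trans (sym (ℚ.*-assoc c c⁻¹ ε)) (trans (cong (ℚ._* ε) (ℚ.*-inverseʳ c)) (ℚ.*-identityˡ ε))
  where
  instance
    c-nonZero : ℚ.NonZero c
    c-nonZero = ℚ.pos⇒nonZero c
  c⁻¹ = ℚ.1/ c

eventually-near-cube : ∀ {n} (y : Vector ℝ n) → (∀ j → 0ᴿ ≤ᴿ y j × y j ≤ᴿ 1ᴿ) → ∀ {δ} → 0ℚ ℚ.< δ →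
  ∃ λ N → ∀ l → N ≤ l → ∀ j → 0ℚ ℚ.≤ seq (y j) l ℚ.+ δ × seq (y j) l ℚ.≤ 1ℚ ℚ.+ δ
eventually-near-cube y y∈ {δ} 0<δ = eventually-all λ j →
  let M , p = proj₁ (y∈ j) δ 0<δ
      N , q = proj₂ (y∈ j) δ 0<δ
  in M ℕ.⊔ N , λ l M⊔N≤l →
       p l (ℕ.m⊔n≤o⇒m≤o M N M⊔N≤l) , q l (ℕ.m⊔n≤o⇒n≤o M N M⊔N≤l)

roundingError-≤ : ∀ {k m n} .{{_ : NonZero k}} .{{_ : NonZero n}} {A : Matrix ℕ m n} → Monotone k A →
  ∀ y → (∀ j → 0ᴿ ≤ᴿ y j × y j ≤ᴿ 1ᴿ) →
  roundingError (λ i j → fromℕ (A i j)) y ≤ᴿ fromℕ (k * Dᵖᵉʳᵐ k n)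
roundingError-≤ {k} {n = n} {A} mon y y∈ ε 0<ε =
  -- The approximation costs n k δ in total, so δ is taken as ε / (n k).
  let δ , 0<δ , c*δ≡ε = divide (ι (+ (n * k))) {{ι-pos (n * k) {{ℕ.m*n≢0 n k}}}} 0<ε
      N₀ , near = eventually-near-cube y y∈ 0<δ
  in N₀ , λ N N≥ →
    -- The vertex may change with `N`: only the `N`-th term of the minimum has to be bounded, so no
    -- single vertex must serve the whole sequence.
    let x , x≤1 , h = rational-rounding mon 0<δ (λ j → seq (y j) N) (near N N≥)
    in seq-roundingError-≤ (λ i j → fromℕ (A i j)) y x x≤1 N
         (ℚ.+-mono-≤ (0≤ι (k * Dᵖᵉʳᵐ k n)) (ℚ.<⇒≤ 0<ε))
         λ i → subst (λ e → ℚ.∣ ℚΣ.sum (λ j → ι (+ A i j) ℚ.* (ι (+ x j) ℚ.- seq (y j) N)) ∣ ℚ.≤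
                       ι (+ (k * Dᵖᵉʳᵐ k n)) ℚ.+ e) c*δ≡ε (h i)

theorem5 : (k n : ℕ) .{{_ : NonZero k}} .{{_ : NonZero n}} →
    Dᵐᵒⁿ k n ≤ᴸ embed (fromℕ (k * Dᵖᵉʳᵐ k n))
-- A rational below the iterated supremum is, by definition, below the rounding error of one matrix
-- at one point.
theorem5 k n q ((m , A , mon) , (y , y∈) , below) =
  embed-mono (roundingError (λ i j → fromℕ (A i j)) y) (fromℕ (k * Dᵖᵉʳᵐ k n))
    (roundingError-≤ mon y y∈) q below
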